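{- Let $k\in\mathbb{R}_{\ge0}$, let $(A,B,C)\in\mathbb{R}_+^3$ be a $k$-initial triple and $(a,b,c)\in\mathbb{R}_+^3$ a $0$-initial triple. Let $\mathbf{w}=[w_1,w_2,\dots]$ be an infinite reduced sequence, and for $n\ge1$ put $(X_n,Y_n,Z_n)=\mathcal{M}_k^{\mathbf{w}_n}(A,B,C)$ and $(x_n,y_n,z_n)=\mathcal{M}^{\mathbf{w}_n}(a,b,c)$. (1) If each of $1,2,3$ appears infinitely many times in $\mathbf{w}$, then there is a real number $q$ such that $\lim_{n\to\infty}X_n/x_n=\lim_{n\to\infty}Y_n/y_n=\lim_{n\to\infty}Z_n/z_n=q$. (2) If some index $i\in\{1,2,3\}$ appears only finitely many times in $\mathbf{w}$, then there is a real number $q$ such that for both indices $j\in\{1,2,3\}\setminus\{i\}$, the ratio of the $j$-th component of $(X_n,Y_n,Z_n)$ to the $j$-th component of $(x_n,y_n,z_n)$ converges to $q$ as $n\to\infty$.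
   Context: For $k\in\mathbb{R}_{\ge0}$ define maps on $\mathbb{R}_+^3$: $\mathcal{M}_{1;k}(X,Y,Z)=(k+Y+Z,Y,Z)$, $\mathcal{M}_{2;k}(X,Y,Z)=(X,k+X+Z,Z)$, $\mathcal{M}_{3;k}(X,Y,Z)=(X,Y,k+X+Y)$, and $\mathcal{M}_i=\mathcal{M}_{i;0}$. A $k$-initial triple is $(A,B,C)\in\mathbb{R}_+^3$ with $A\neq B+C+k$, $B\neq A+C+k$, $C\neq A+B+k$. A sequence $\mathbf{w}=[w_1,w_2,\dots]$ with $w_i\in\{1,2,3\}$ is reduced if $w_i\neq w_{i+1}$ for all $i$; $\mathbf{w}_n=[w_1,\dots,w_n]$, and $\mathcal{M}_k^{\mathbf{w}_n}=\mathcal{M}_{w_n;k}\circ\cdots\circ\mathcal{M}_{w_1;k}$, $\mathcal{M}^{\mathbf{w}_n}=\mathcal{M}_{w_n}\circ\cdots\circ\mathcal{M}_{w_1}$. (The triples $\mathcal{M}_k^{\mathbf{w}}(A,B,C)$ form the $k$-generalized Euclid tree; for $k=0$ the classical Euclid tree.) -}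

module Defs where

open import Algebra.Apartness.Bundles using (HeytingCommutativeRing; HeytingField)
import Algebra.Definitions.RawMonoid as RawMonoidDefinitions
open import Algebra.Bundles using (CommutativeRing)
open import Data.Fin using (Fin)
open import Data.Fin.Patterns using (0F; 1F; 2F)
open import Data.Nat as ℕ using (ℕ; zero; suc)
open import Data.Product using (∃-syntax; _×_; _,_; proj₁)
open import Data.Sum using (_⊎_; inj₁; inj₂)
open import Data.Vec using (Vec; []; _∷_; lookup)
open import Level using (Level; _⊔_) renaming (suc to lsuc)
open import Relation.Binary.Core using (Rel)
open import Relation.Binary.PropositionalEquality using (_≡_; _≢_)
open import Relation.Binary.Structures using (IsStrictPartialOrder)
open import Relation.Nullary using (¬_; contradiction)

-- Axioms for the real numbers: an Archimedean ordered field in which every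
-- Cauchy sequence converges.  Classically ℝ is the only model up to isomorphism.
-- The order is not assumed decidable (only cotransitive, through _#_), so that
-- the axioms are also those of the constructive (Bishop) reals.
record Reals (c ℓ₁ ℓ₂ ℓ₃ : Level) : Set (lsuc (c ⊔ ℓ₁ ⊔ ℓ₂ ⊔ ℓ₃)) where
  infix 4 _<_ _≤_

  field
    heytingField : HeytingField c ℓ₁ ℓ₂

  open HeytingField heytingField public renaming (Carrier to ℝ)
  open HeytingCommutativeRing heytingCommutativeRing public using (commutativeRing)

  field
    _<_                  : Rel ℝ ℓ₃
    isStrictPartialOrder : IsStrictPartialOrder _≈_ _<_
    <⇒#                  : ∀ {x y} → x < y → x # y
    #⇒<⊎>                : ∀ {x y} → x # y → x < y ⊎ y < x
    +-monoʳ-<            : ∀ x {y z} → y < z → x + y < x + z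
    *-pos                : ∀ {x y} → 0# < x → 0# < y → 0# < x * y

  _≤_ : Rel ℝ ℓ₃
  x ≤ y = ¬ (y < x)

  ∣_∣<_ : ℝ → ℝ → Set ℓ₃
  ∣ x ∣< ε = (- ε < x) × (x < ε)

  Cauchy : (ℕ → ℝ) → Set (c ⊔ ℓ₃)
  Cauchy s = ∀ ε → 0# < ε →
    ∃[ N ] (∀ m n → N ℕ.≤ m → N ℕ.≤ n → ∣ s m - s n ∣< ε)

  _⟶_ : (ℕ → ℝ) → ℝ → Set (c ⊔ ℓ₃)
  s ⟶ q = ∀ ε → 0# < ε → ∃[ N ] (∀ n → N ℕ.≤ n → ∣ s n - q ∣< ε)

  open RawMonoidDefinitions (CommutativeRing.+-rawMonoid commutativeRing) using () renaming (_×_ to _·_)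

  field
    archimedean : ∀ x → ∃[ n ] (x < n · 1#)
    complete    : ∀ s → Cauchy s → ∃[ q ] (s ⟶ q)

module EuclidTree {c ℓ₁ ℓ₂ ℓ₃ : Level} (R : Reals c ℓ₁ ℓ₂ ℓ₃) where
  open Reals R public
  private
    module < = IsStrictPartialOrder isStrictPartialOrder

  record ℝ≥0 : Set (c ⊔ ℓ₃) where
    constructor nonNeg
    field
      value   : ℝ
      0≤value : 0# ≤ value

  record ℝ₊ : Set (c ⊔ ℓ₃) where
    constructor pos
    field
      value   : ℝ
      0<value : 0# < value

  nonNeg+pos : ∀ {x y} → 0# ≤ x → 0# < y → 0# < x + y
  nonNeg+pos {x} {y} 0≤x 0<y = from (#-cotrans (<⇒# x<x+y) 0#)
    where
    x<x+y : x < x + y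
    x<x+y = <.<-respˡ-≈ (+-identityʳ x) (+-monoʳ-< x 0<y)

    from : x # 0# ⊎ 0# # (x + y) → 0# < x + y
    from (inj₁ x#0) with #⇒<⊎> x#0
    ... | inj₁ x<0 = contradiction x<0 0≤x
    ... | inj₂ 0<x = <.trans 0<x x<x+y
    from (inj₂ 0#x+y) with #⇒<⊎> 0#x+y
    ... | inj₁ 0<x+y = 0<x+y
    ... | inj₂ x+y<0 = contradiction (<.trans x<x+y x+y<0) 0≤x

  infixl 6 _+₊_ _+⁰_

  _+⁰_ : ℝ≥0 → ℝ₊ → ℝ₊
  nonNeg k 0≤k +⁰ pos x 0<x = pos (k + x) (nonNeg+pos 0≤k 0<x)

  _+₊_ : ℝ₊ → ℝ₊ → ℝ₊
  pos x 0<x +₊ pos y 0<y = pos (x + y) (nonNeg+pos (<.asym 0<x) 0<y)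

  infixl 7 _/_

  -- #⇒invertible, applied to y # 0#, gives an inverse of y - 0#, and y - 0# ≈ y.
  _/_ : ℝ₊ → ℝ₊ → ℝ
  pos x _ / pos y 0<y = x * proj₁ (#⇒invertible (#-sym (<⇒# 0<y)))

  0≥0 : ℝ≥0
  0≥0 = nonNeg 0# (<.irrefl refl)

  -- The indices 1, 2, 3 are represented by 0F, 1F, 2F.
  𝓜 : ℝ≥0 → Fin 3 → Vec ℝ₊ 3 → Vec ℝ₊ 3
  𝓜 k 0F (X ∷ Y ∷ Z ∷ []) = (k +⁰ Y +₊ Z) ∷ Y ∷ Z ∷ []
  𝓜 k 1F (X ∷ Y ∷ Z ∷ []) = X ∷ (k +⁰ X +₊ Z) ∷ Z ∷ []
  𝓜 k 2F (X ∷ Y ∷ Z ∷ []) = X ∷ Y ∷ (k +⁰ X +₊ Y) ∷ []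

  Initial : ℝ≥0 → Vec ℝ₊ 3 → Set ℓ₁
  Initial (nonNeg k _) (pos A _ ∷ pos B _ ∷ pos C _ ∷ []) =
    ¬ (A ≈ B + C + k) × ¬ (B ≈ A + C + k) × ¬ (C ≈ A + B + k)

  -- A sequence w : ℕ → Fin 3 stands for [w₁, w₂, …] with w i = wᵢ₊₁, so
  -- 𝓜^ k w n is the composite over the first n letters w 0, …, w (n ∸ 1).
  𝓜^ : ℝ≥0 → (ℕ → Fin 3) → ℕ → Vec ℝ₊ 3 → Vec ℝ₊ 3
  𝓜^ k w zero    t = t
  𝓜^ k w (suc n) t = 𝓜 k (w n) (𝓜^ k w n t)

  ratio : ℝ≥0 → (ℕ → Fin 3) → Vec ℝ₊ 3 → Vec ℝ₊ 3 → Fin 3 → ℕ → ℝ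
  ratio k w T t j n = lookup (𝓜^ k w n T) j / lookup (𝓜^ 0≥0 w n t) j

Reduced : (ℕ → Fin 3) → Set
Reduced w = ∀ n → w n ≢ w (suc n)

InfinitelyOften : (ℕ → Fin 3) → Fin 3 → Set
InfinitelyOften w i = ∀ N → ∃[ n ] (N ℕ.≤ n × w n ≡ i)

FinitelyOften : (ℕ → Fin 3) → Fin 3 → Set
FinitelyOften w i = ∃[ N ] (∀ n → N ℕ.≤ n → w n ≢ i)

{-# OPTIONS --safe #-}
-- Adding k to every component turns the k-generalized maps into the classical
-- ones, so U = X + k and x are two orbits of the same linear maps.  Each of these
-- maps permutes, up to sign, the minors Uᵢxⱼ − Uⱼxᵢ or duplicates one of them, so
-- the minors stay bounded by some D.  In a reduced orbit the component of x moved
-- last exceeds n m, where m > 0 bounds all components from below; dividing the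
-- minors by it shows |Uⱼ − c xⱼ| < ε xⱼ for all j at some time, where c is the
-- ratio of the components moved last.  The maps add components, so this estimate
-- persists, and all the ratios Uⱼ/xⱼ converge to a common limit.  Finally k/xⱼ
-- tends to 0 as soon as j is moved infinitely often, since each such move
-- increases xⱼ by more than m.
module Submission where

open import Defs
open import Algebra.Bundles using (CommutativeRing)
import Algebra.Apartness.Properties.HeytingCommutativeRing as HeytingProperties
import Algebra.Definitions.RawMonoid as RawMonoidDefinitions
import Algebra.Properties.Group as GroupProperties
import Algebra.Properties.Ring as RingProperties
import Algebra.Solver.Ring.NaturalCoefficients.Default as NaturalSolver
open import Data.Fin using (Fin; zero; suc; punchIn; _≟_)
open import Data.Fin.Patterns using (0F; 1F; 2F)
open import Data.Fin.Properties using (punchInᵢ≢i)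
open import Data.Nat as ℕ using (ℕ; zero; suc; _⊔_)
import Data.Nat.Properties as ℕₚ
open import Data.Product using (∃-syntax; _×_; _,_; proj₁; proj₂)
open import Data.Sum using (inj₁; inj₂)
open import Data.Vec using (Vec; _∷_; []; lookup)
open import Level using (Level)
open import Relation.Binary.Bundles using (StrictPartialOrder)
import Relation.Binary.Reasoning.StrictPartialOrder as StrictReasoning
open import Relation.Binary.PropositionalEquality as ≡ using (_≡_; _≢_)
open import Relation.Binary.Structures using (IsStrictPartialOrder)
open import Relation.Nullary using (yes; no; contradiction)

-- Reduced words over three letters.

-- The letter other than i and j; the diagonal values are junk.
third : Fin 3 → Fin 3 → Fin 3
third 0F 0F = 0F
third 0F 1F = 2F
third 0F 2F = 1F
third 1F 0F = 2F
third 1F 1F = 1F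
third 1F 2F = 0F
third 2F 0F = 1F
third 2F 1F = 0F
third 2F 2F = 2F

third-comm : ∀ i j → third i j ≡ third j i
third-comm 0F 0F = ≡.refl
third-comm 0F 1F = ≡.refl
third-comm 0F 2F = ≡.refl
third-comm 1F 0F = ≡.refl
third-comm 1F 1F = ≡.refl
third-comm 1F 2F = ≡.refl
third-comm 2F 0F = ≡.refl
third-comm 2F 1F = ≡.refl
third-comm 2F 2F = ≡.refl

third≢ : ∀ i j → j ≢ i → third i j ≢ i
third≢ 0F 0F j≢i = j≢i
third≢ 0F 1F j≢i = λ ()
third≢ 0F 2F j≢i = λ ()
third≢ 1F 0F j≢i = λ ()
third≢ 1F 1F j≢i = j≢i
third≢ 1F 2F j≢i = λ ()
third≢ 2F 0F j≢i = λ ()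
third≢ 2F 1F j≢i = λ ()
third≢ 2F 2F j≢i = j≢i

≢-≢⇒third : ∀ i j h → j ≢ i → h ≢ i → h ≢ j → h ≡ third i j
≢-≢⇒third 0F 0F _  j≢i _ _ = contradiction ≡.refl j≢i
≢-≢⇒third 1F 1F _  j≢i _ _ = contradiction ≡.refl j≢i
≢-≢⇒third 2F 2F _  j≢i _ _ = contradiction ≡.refl j≢i
≢-≢⇒third 0F 1F 0F _ h≢i _ = contradiction ≡.refl h≢i
≢-≢⇒third 0F 1F 1F _ _ h≢j = contradiction ≡.refl h≢j
≢-≢⇒third 0F 1F 2F _ _ _   = ≡.refl
≢-≢⇒third 0F 2F 0F _ h≢i _ = contradiction ≡.refl h≢i
≢-≢⇒third 0F 2F 1F _ _ _   = ≡.refl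
≢-≢⇒third 0F 2F 2F _ _ h≢j = contradiction ≡.refl h≢j
≢-≢⇒third 1F 0F 0F _ _ h≢j = contradiction ≡.refl h≢j
≢-≢⇒third 1F 0F 1F _ h≢i _ = contradiction ≡.refl h≢i
≢-≢⇒third 1F 0F 2F _ _ _   = ≡.refl
≢-≢⇒third 1F 2F 0F _ _ _   = ≡.refl
≢-≢⇒third 1F 2F 1F _ h≢i _ = contradiction ≡.refl h≢i
≢-≢⇒third 1F 2F 2F _ _ h≢j = contradiction ≡.refl h≢j
≢-≢⇒third 2F 0F 0F _ _ h≢j = contradiction ≡.refl h≢j
≢-≢⇒third 2F 0F 1F _ _ _   = ≡.refl
≢-≢⇒third 2F 0F 2F _ h≢i _ = contradiction ≡.refl h≢i
≢-≢⇒third 2F 1F 0F _ _ _   = ≡.refl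
≢-≢⇒third 2F 1F 1F _ _ h≢j = contradiction ≡.refl h≢j
≢-≢⇒third 2F 1F 2F _ h≢i _ = contradiction ≡.refl h≢i

-- Once `i` has disappeared, a reduced word alternates between the two remaining letters, so `j`
-- occurs at one of any two consecutive positions; `N ⊔ M` and its successor are inspected.
finitelyOften⇒infinitelyOften : ∀ {w i} → Reduced w → FinitelyOften w i →
  ∀ j → j ≢ i → InfinitelyOften w j
finitelyOften⇒infinitelyOften {w} {i} reduced (N , avoids) j j≢i M
  with w (N ⊔ M) ≟ j
... | yes eq = N ⊔ M , ℕₚ.m≤n⊔m N M , eq
... | no neq = suc (N ⊔ M) , ℕₚ.m≤n⇒m≤1+n (ℕₚ.m≤n⊔m N M) ,
  -- Both the next letter and `j` differ from `i` and from the current letter, so each is the third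
  -- letter.
  ≡.trans (≢-≢⇒third _ _ _ here≢i next≢i next≢here) (≡.sym (≢-≢⇒third _ _ _ here≢i j≢i (≡.≢-sym neq)))
  where
  here≢i : w (N ⊔ M) ≢ i
  here≢i = avoids (N ⊔ M) (ℕₚ.m≤m⊔n N M)
  next≢i : w (suc (N ⊔ M)) ≢ i
  next≢i = avoids (suc (N ⊔ M)) (ℕₚ.m≤n⇒m≤1+n (ℕₚ.m≤m⊔n N M))
  next≢here : w (suc (N ⊔ M)) ≢ w (N ⊔ M)
  next≢here = ≡.≢-sym (reduced (N ⊔ M))

module _ {c ℓ₁ ℓ₂ ℓ₃ : Level} (R : Reals c ℓ₁ ℓ₂ ℓ₃) where
  open EuclidTree R hiding (zero)
  open CommutativeRing commutativeRing using (commutativeSemiring; ring; +-group; +-rawMonoid)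
  open IsStrictPartialOrder isStrictPartialOrder using ()
    renaming (trans to <-trans; <-respˡ-≈ to <-respˡ; <-respʳ-≈ to <-respʳ)
  open HeytingProperties heytingCommutativeRing using (1#0; x-0≈x)
  open GroupProperties +-group using (//-rightDividesˡ; //-rightDividesʳ)
  open RingProperties ring using (-‿distribˡ-*; -‿distribʳ-*; -‿involutive)
  open RawMonoidDefinitions +-rawMonoid using () renaming (_×_ to _·_)
  open NaturalSolver commutativeSemiring using (solve; _:+_; _:*_; _:=_; con)

  strictPartialOrder : StrictPartialOrder c ℓ₁ ℓ₃
  strictPartialOrder = record { isStrictPartialOrder = isStrictPartialOrder }
  open StrictReasoning strictPartialOrder

  -- Ordered field arithmetic and reciprocals.

  +-monoˡ-< : ∀ z {x y} → x < y → x + z < y + z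
  +-monoˡ-< z {x} {y} x<y = <-respˡ (+-comm z x) (<-respʳ (+-comm z y) (+-monoʳ-< z x<y))

  +-mono-< : ∀ {x y u v} → x < y → u < v → x + u < y + v
  +-mono-< x<y u<v = <-trans (+-monoˡ-< _ x<y) (+-monoʳ-< _ u<v)

  x<x+y : ∀ x {y} → 0# < y → x < x + y
  x<x+y x 0<y = <-respˡ (+-identityʳ x) (+-monoʳ-< x 0<y)

  0<x+y : ∀ {x y} → 0# < x → 0# < y → 0# < x + y
  0<x+y 0<x 0<y = <-trans 0<x (x<x+y _ 0<y)

  x<y⇒0<y-x : ∀ {x y} → x < y → 0# < y - x
  x<y⇒0<y-x {x} x<y = <-respˡ (-‿inverseʳ x) (+-monoˡ-< (- x) x<y)

  *-monoˡ-< : ∀ {x y z} → 0# < z → x < y → x * z < y * z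
  *-monoˡ-< {x} {y} {z} 0<z x<y = begin-strict
    x * z                ≈⟨ +-identityˡ (x * z) ⟨
    0# + x * z           <⟨ +-monoˡ-< (x * z) (*-pos (x<y⇒0<y-x x<y) 0<z) ⟩
    (y - x) * z + x * z  ≈⟨ distribʳ z (y - x) x ⟨
    (y - x + x) * z      ≈⟨ *-congʳ (//-rightDividesˡ x y) ⟩
    y * z                ∎

  *-monoʳ-< : ∀ {x y z} → 0# < z → x < y → z * x < z * y
  *-monoʳ-< 0<z x<y = <-respˡ (*-comm _ _) (<-respʳ (*-comm _ _) (*-monoˡ-< 0<z x<y))

  -x*-x≈x*x : ∀ x → - x * - x ≈ x * x
  -x*-x≈x*x x = trans (sym (-‿distribˡ-* x (- x)))
    (trans (-‿cong (sym (-‿distribʳ-* x x))) (-‿involutive (x * x)))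

  -- Source of two sign facts absent from the axioms: `0<1`, as 1 is its own square, and `0<recip`.
  x#0⇒0<x*x : ∀ {x} → x # 0# → 0# < x * x
  x#0⇒0<x*x {x} x#0 with #⇒<⊎> x#0
  ... | inj₂ 0<x = *-pos 0<x 0<x
  ... | inj₁ x<0 = <-respʳ (-x*-x≈x*x x) (*-pos 0<-x 0<-x)
    where
    0<-x : 0# < - x
    0<-x = <-respʳ (+-identityˡ (- x)) (x<y⇒0<y-x x<0)

  0<1 : 0# < 1#
  0<1 = <-respʳ (*-identityˡ 1#) (x#0⇒0<x*x 1#0)

  -- The same term as the inverse inside `_/_`, so that `ratio` unfolds to a product with `recip`.
  recip : ∀ {x} → 0# < x → ℝ
  recip 0<x = proj₁ (#⇒invertible (#-sym (<⇒# 0<x)))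

  *-recip : ∀ {x} (0<x : 0# < x) → x * recip 0<x ≈ 1#
  *-recip {x} 0<x = trans (*-congʳ (sym (x-0≈x x))) (proj₂ (proj₂ (#⇒invertible (#-sym (<⇒# 0<x)))))

  -- The reciprocal r of x equals x r², and r is apart from 0 because it is invertible.
  0<recip : ∀ {x} (0<x : 0# < x) → 0# < recip 0<x
  0<recip {x} 0<x = <-respʳ x*[r*r]≈r (*-pos 0<x (x#0⇒0<x*x r#0))
    where
    r = recip 0<x

    r#0 : r # 0#
    r#0 = invertible⇒# (x , trans (*-congˡ (x-0≈x r)) (*-recip 0<x)
                          , trans (*-congʳ (x-0≈x r)) (trans (*-comm r x) (*-recip 0<x)))

    x*[r*r]≈r : x * (r * r) ≈ r
    x*[r*r]≈r = trans (sym (*-assoc x r r)) (trans (*-congʳ (*-recip 0<x)) (*-identityˡ r))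

  *-*-recip : ∀ x {y} (0<y : 0# < y) → x * (y * recip 0<y) ≈ x
  *-*-recip x 0<y = trans (*-congˡ (*-recip 0<y)) (*-identityʳ x)

  -- Opaque because `with` would otherwise normalise the proof terms of the solver.
  opaque
    half : ∀ {ε} → 0# < ε → ∃[ δ ] (0# < δ × δ + δ ≈ ε)
    half {ε} 0<ε = ε * r , *-pos 0<ε (0<recip 0<2) ,
      trans (solve 2 (λ ε r → ε :* r :+ ε :* r := ε :* ((con 1 :+ con 1) :* r)) refl ε r) (*-*-recip ε 0<2)
      where
      0<2 : 0# < 1# + 1#
      0<2 = 0<x+y 0<1 0<1

      r : ℝ
      r = recip 0<2

  -- The Archimedean property and bounds for finite families.

  ι : ℕ → ℝ
  ι n = n · 1#

  opaque
    archimedean-* : ∀ x {y} → 0# < y → ∃[ n ] (x < ι n * y)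
    archimedean-* x {y} 0<y with archimedean (x * recip 0<y)
    ... | n , xr<n = n , (begin-strict
      x                      ≈⟨ *-*-recip x 0<y ⟨
      x * (y * recip 0<y)    ≈⟨ solve 3 (λ x y r → x :* (y :* r) := x :* r :* y) refl x y _ ⟩
      x * recip 0<y * y      <⟨ *-monoˡ-< 0<y xr<n ⟩
      ι n * y                ∎)

  0<1+ι : ∀ n → 0# < 1# + ι n
  0<1+ι zero    = <-respʳ (sym (+-identityʳ 1#)) 0<1
  0<1+ι (suc n) = 0<x+y 0<1 (0<1+ι n)

  opaque
    upperBound₁ : ∀ x → ∃[ B ] (0# < B × x < B)
    upperBound₁ x with archimedean x
    -- Adding 1 makes the bound positive even when `n` is 0.
    ... | n , x<n = 1# + ι n , 0<1+ι n , <-trans x<n (<-respʳ (+-comm (ι n) 1#) (x<x+y (ι n) 0<1))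

    -- A sum of positive bounds replaces the maximum, so no two reals have to be compared.
    upperBound : ∀ {n} (f : Fin n → ℝ) → ∃[ B ] (0# < B × (∀ i → f i < B))
    upperBound {zero}  f = 1# , 0<1 , λ ()
    upperBound {suc n} f with upperBound₁ (f zero) | upperBound (λ i → f (suc i))
    ... | a , 0<a , f₀<a | b , 0<b , f<b = a + b , 0<x+y 0<a 0<b , λ where
      zero    → <-trans f₀<a (x<x+y a 0<b)
      (suc i) → <-trans (f<b i) (<-respʳ (+-comm b a) (x<x+y b 0<a))

    -- The reciprocal of an upper bound for the reciprocals.
    lowerBound : ∀ {n} (f : Fin n → ℝ) → (∀ i → 0# < f i) → ∃[ m ] (0# < m × (∀ i → m < f i))
    lowerBound f 0<f with upperBound (λ i → recip (0<f i))
    ... | B , 0<B , r<B = recip 0<B , 0<recip 0<B , λ i →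
      begin-strict
        recip 0<B                              ≈⟨ *-*-recip (recip 0<B) (0<f i) ⟨
        recip 0<B * (f i * recip (0<f i))      <⟨ *-monoʳ-< (0<recip 0<B) (*-monoʳ-< (0<f i) (r<B i)) ⟩
        recip 0<B * (f i * B)                  ≈⟨ solve 3 (λ s f B → s :* (f :* B) := f :* (B :* s)) refl _ (f i) B ⟩
        f i * (B * recip 0<B)                  ≈⟨ *-*-recip (f i) 0<B ⟩
        f i                                    ∎

  -- Approximate equality and limits.

  -- |x − y| < ε without subtraction, so that the semiring solver applies.
  record Close (ε x y : ℝ) : Set ℓ₃ where
    constructor within
    field
      upper : x < y + ε
      lower : y < x + ε

  Close-sym : ∀ {ε x y} → Close ε x y → Close ε y x
  Close-sym (within x<y y<x) = within y<x x<y

  Close-trans : ∀ {δ ε x y z} → Close δ x y → Close ε y z → Close (δ + ε) x z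
  Close-trans {δ} {ε} {x} {y} {z} (within x<y y<x) (within y<z z<y) = within
    (begin-strict
      x            <⟨ x<y ⟩
      y + δ        <⟨ +-monoˡ-< δ y<z ⟩
      z + ε + δ    ≈⟨ solve 3 (λ z ε δ → z :+ ε :+ δ := z :+ (δ :+ ε)) refl z ε δ ⟩
      z + (δ + ε)  ∎)
    (begin-strict
      z            <⟨ z<y ⟩
      y + ε        <⟨ +-monoˡ-< ε y<x ⟩
      x + δ + ε    ≈⟨ +-assoc x δ ε ⟩
      x + (δ + ε)  ∎)

  Close-resp : ∀ {δ ε x x′ y y′} → δ ≈ ε → x ≈ x′ → y ≈ y′ → Close δ x y → Close ε x′ y′
  Close-resp δ≈ε x≈x′ y≈y′ (within x<y y<x) = within
    (<-respˡ x≈x′ (<-respʳ (+-cong y≈y′ δ≈ε) x<y))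
    (<-respˡ y≈y′ (<-respʳ (+-cong x≈x′ δ≈ε) y<x))

  Close-resp-ε : ∀ {δ ε x y} → δ ≈ ε → Close δ x y → Close ε x y
  Close-resp-ε δ≈ε = Close-resp δ≈ε refl refl

  Close-+ : ∀ {δ ε x x′ y y′} → Close δ x y → Close ε x′ y′ → Close (δ + ε) (x + x′) (y + y′)
  Close-+ (within x<y y<x) (within x′<y′ y′<x′) = within
    (<-respʳ (interchange _ _ _ _) (+-mono-< x<y x′<y′))
    (<-respʳ (interchange _ _ _ _) (+-mono-< y<x y′<x′))
    where
    interchange : ∀ a b c d → a + b + (c + d) ≈ a + c + (b + d)
    interchange = solve 4 (λ a b c d → a :+ b :+ (c :+ d) := a :+ c :+ (b :+ d)) refl

  Close-* : ∀ {δ x y z} → 0# < z → Close δ x y → Close (δ * z) (x * z) (y * z)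
  Close-* 0<z (within x<y y<x) = within
    (<-respʳ (distribʳ _ _ _) (*-monoˡ-< 0<z x<y))
    (<-respʳ (distribʳ _ _ _) (*-monoˡ-< 0<z y<x))

  [x+y]-x≈y : ∀ x y → x + y - x ≈ y
  [x+y]-x≈y x y = trans (+-congʳ (+-comm x y)) (//-rightDividesʳ x y)

  Close⇒∣-∣< : ∀ {ε x y} → Close ε x y → ∣ x - y ∣< ε
  Close⇒∣-∣< {ε} {x} {y} (within x<y+ε y<x+ε) =
    (begin-strict
      - ε            ≈⟨ [x+y]-x≈y y (- ε) ⟨
      y - ε - y      <⟨ +-monoˡ-< (- y) (+-monoˡ-< (- ε) y<x+ε) ⟩
      x + ε - ε - y  ≈⟨ +-congʳ (//-rightDividesʳ ε x) ⟩
      x - y          ∎) ,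
    <-respʳ ([x+y]-x≈y y ε) (+-monoˡ-< (- y) x<y+ε)

  ∣-∣<⇒Close : ∀ {ε x y} → ∣ x - y ∣< ε → Close ε x y
  ∣-∣<⇒Close {ε} {x} {y} (-ε<x-y , x-y<ε) = within
    (begin-strict
      x          ≈⟨ //-rightDividesˡ y x ⟨
      x - y + y  <⟨ +-monoˡ-< y x-y<ε ⟩
      ε + y      ≈⟨ +-comm ε y ⟩
      y + ε      ∎)
    (begin-strict
      y                ≈⟨ //-rightDividesʳ ε y ⟨
      y + ε - ε        ≈⟨ +-comm (y + ε) (- ε) ⟩
      - ε + (y + ε)    <⟨ +-monoˡ-< (y + ε) -ε<x-y ⟩
      x - y + (y + ε)  ≈⟨ +-assoc (x - y) y ε ⟨
      x - y + y + ε    ≈⟨ +-congʳ (//-rightDividesˡ y x) ⟩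
      x + ε            ∎)

  EventuallyClose : ∀ {a} {J : Set a} → (J → ℕ → ℝ) → ℝ → ℝ → Set _
  EventuallyClose s ε c = ∃[ N ] (∀ n → N ℕ.≤ n → ∀ j → Close ε (s j n) c)

  -- The centre `c` may vary with `ε`. Late values of `s j₀` share a centre, so they are close to
  -- each other and `s j₀` is Cauchy; every other `s j` stays close to `s j₀` and inherits its
  -- limit.
  common-limit : ∀ {a} {J : Set a} → J → (s : J → ℕ → ℝ) →
    (∀ ε → 0# < ε → ∃[ c ] EventuallyClose s ε c) → ∃[ q ] (∀ j → s j ⟶ q)
  common-limit j₀ s close = q , λ j → converges j
    where
    cauchy : Cauchy (s j₀)
    cauchy ε 0<ε with half 0<ε
    ... | δ , 0<δ , 2δ≈ε with close δ 0<δ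
    ... | c , N , near = N , λ m n N≤m N≤n →
      Close⇒∣-∣< (Close-resp-ε 2δ≈ε (Close-trans (near m N≤m j₀) (Close-sym (near n N≤n j₀))))

    q : ℝ
    q = proj₁ (complete (s j₀) cauchy)

    converges : ∀ j → s j ⟶ q
    converges j ε 0<ε =
      -- The route from `s j n` to `q` passes through `c` and `s j₀ n`, at costs `η`, `η` and `δ`.
      let δ , 0<δ , 2δ≈ε = half 0<ε
          η , 0<η , 2η≈δ = half 0<δ
          M , tail = proj₂ (complete (s j₀) cauchy) δ 0<δ
          c , N , near = close η 0<η
      in N ⊔ M , λ n N⊔M≤n → let
          N≤n = ℕₚ.≤-trans (ℕₚ.m≤m⊔n N M) N⊔M≤n
          M≤n = ℕₚ.≤-trans (ℕₚ.m≤n⊔m N M) N⊔M≤n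
      in Close⇒∣-∣< (Close-resp-ε 2δ≈ε (Close-trans
           (Close-resp-ε 2η≈δ (Close-trans (near n N≤n j) (Close-sym (near n N≤n j₀))))
           (∣-∣<⇒Close (tail n M≤n))))

  -- Orbits of the classical maps, in real coordinates.

  module Orbits (w : ℕ → Fin 3) where
    -- Abstracted from `𝓜` so that the shifted sequence `U` qualifies as well as `x`. In `moved`,
    -- either of the two other letters may be taken as the first summand.
    record IsOrbit (u : ℕ → Fin 3 → ℝ) : Set (c Level.⊔ ℓ₁ Level.⊔ ℓ₃) where
      field
        positive : ∀ n j → 0# < u n j
        moved    : ∀ n {j} → j ≢ w n → u (suc n) (w n) ≈ u n j + u n (third (w n) j)
        kept     : ∀ n {j} → j ≢ w n → u (suc n) j ≈ u n j

      balanced : ∀ n {j} → j ≢ w n →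
        u (suc n) (w n) ≈ u (suc n) j + u (suc n) (third (w n) j)
      balanced n j≢ = trans (moved n j≢)
        (sym (+-cong (kept n j≢) (kept n (third≢ (w n) _ j≢))))

    -- Growth along a reduced word.

    module Growth (reduced : Reduced w) {x} (orbit : IsOrbit x) where
      open IsOrbit orbit

      private
        -- The estimates start at time 1, the first time at which some letter has been moved: the
        -- last letter moved before time `suc n` is `w n`.
        bound = lowerBound (x 1) (positive 1)

      m : ℝ
      m = proj₁ bound

      0<m : 0# < m
      0<m = proj₁ (proj₂ bound)

      m<x : ∀ n j → m < x (suc n) j
      m<x zero    j = proj₂ (proj₂ bound) j
      m<x (suc n) j with j ≟ w (suc n)
      ... | no  j≢     = <-respʳ (sym (kept (suc n) j≢)) (m<x n j)
      ... | yes ≡.refl = begin-strict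
        m                                                         <⟨ m<x n (w n) ⟩
        x (suc n) (w n)                                           <⟨ x<x+y _ (positive (suc n) _) ⟩
        x (suc n) (w n) + x (suc n) (third (w (suc n)) (w n))     ≈⟨ moved (suc n) (reduced n) ⟨
        x (suc (suc n)) (w (suc n))                               ∎

      -- As the word is reduced, the component moved last is a summand of the next one moved, and
      -- the other summand exceeds `m`; each step therefore gains `m`.
      n*m<last : ∀ n → ι n * m < x (suc n) (w n)
      n*m<last zero    = <-respˡ (sym (zeroˡ m)) (positive 1 (w 0))
      n*m<last (suc n) = begin-strict
        (1# + ι n) * m                                            ≈⟨ solve 2 (λ n m → (con 1 :+ n) :* m := n :* m :+ m) refl (ι n) m ⟩
        ι n * m + m                                               <⟨ +-mono-< (n*m<last n) (m<x n _) ⟩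
        x (suc n) (w n) + x (suc n) (third (w (suc n)) (w n))     ≈⟨ moved (suc n) (reduced n) ⟨
        x (suc (suc n)) (w (suc n))                               ∎

      -- By `balanced`, the component at `w n` is already the sum of those at `j` and `h`, so moving
      -- `j` adds twice the component at `h` to its old value.
      moved-increases : ∀ n → x (suc n) (w (suc n)) + m < x (suc (suc n)) (w (suc n))
      moved-increases n = begin-strict
        x (suc n) j + m                                   <⟨ +-mono-< (x<x+y _ (positive (suc n) h)) (m<x n h) ⟩
        x (suc n) j + x (suc n) h + x (suc n) h           ≡⟨ ≡.cong (λ i → x (suc n) j + x (suc n) i + x (suc n) h) (third-comm j (w n)) ⟩
        x (suc n) j + x (suc n) (third (w n) j) + x (suc n) h
                                                          ≈⟨ +-congʳ (balanced n (≡.≢-sym (reduced n))) ⟨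
        x (suc n) (w n) + x (suc n) h                     ≈⟨ moved (suc n) (reduced n) ⟨
        x (suc (suc n)) j                                 ∎
        where
        j = w (suc n)
        h = third j (w n)

      bound-step : ∀ {B} n j → B < x (suc n) j → B < x (suc (suc n)) j
      bound-step n j B<x with j ≟ w (suc n)
      ... | no  j≢     = <-respʳ (sym (kept (suc n) j≢)) B<x
      ... | yes ≡.refl = <-trans B<x (<-trans (x<x+y _ 0<m) (moved-increases n))

      bound-persists : ∀ {B n n′} j → n ℕ.≤′ n′ → B < x (suc n) j → B < x (suc n′) j
      bound-persists j (ℕ.≤′-reflexive ≡.refl) B<x = B<x
      bound-persists j (ℕ.≤′-step n≤n′)        B<x = bound-step _ j (bound-persists j n≤n′ B<x)

      opaque
        reaches : ∀ {j} → InfinitelyOften w j → ∀ k → ∃[ N ] (ι k * m < x (suc N) j)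
        reaches {j} often zero    = 0 , <-respˡ (sym (zeroˡ m)) (positive 1 j)
        reaches {j} often (suc k) with reaches often k
        -- The occurrence is sought from `suc N` on, because `moved-increases` concerns the letter
        -- `w (suc n)`.
        ... | N , k*m<x with often (suc N)
        ... | suc n , ℕ.s≤s N≤n , ≡.refl = suc n , (begin-strict
          (1# + ι k) * m                ≈⟨ solve 2 (λ k m → (con 1 :+ k) :* m := k :* m :+ m) refl (ι k) m ⟩
          ι k * m + m                   <⟨ +-monoˡ-< m (bound-persists j (ℕₚ.≤⇒≤′ N≤n) k*m<x) ⟩
          x (suc n) j + m               <⟨ moved-increases n ⟩
          x (suc (suc n)) j             ∎)

      diverges : ∀ {j} → InfinitelyOften w j → ∀ B → ∃[ N ] (∀ n → N ℕ.≤ n → B < x n j)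
      diverges {j} often B with archimedean-* B 0<m
      ... | k , B<k*m with reaches often k
      ... | N , k*m<x = suc N , λ where
        (suc n) (ℕ.s≤s N≤n) → bound-persists j (ℕₚ.≤⇒≤′ N≤n) (<-trans B<k*m k*m<x)

    -- Minors of two orbits and convergence of their quotients.

    module Comparison {u x} (uOrbit : IsOrbit u) (xOrbit : IsOrbit x) where
      private
        module u = IsOrbit uOrbit
        module x = IsOrbit xOrbit

      -- Ranging over both orders of `i` and `j`, the one-sided inequality bounds the minors in
      -- absolute value, without subtraction.
      MinorsBelow : ℝ → ℕ → Set ℓ₃
      MinorsBelow D n = ∀ i j → u n i * x n j < u n j * x n i + D

      -- If `i` is moved and `h` is the third letter, the product `u n j * x n j` cancels from the
      -- new minor of `i` and `j`, leaving the old minor of `h` and `j`. Hence the same `D` works.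
      minors-step : ∀ {D n} → 0# < D → MinorsBelow D n → MinorsBelow D (suc n)
      minors-step {D} {n} 0<D minors i j with i ≟ w n | j ≟ w n
      ... | yes ≡.refl | yes ≡.refl = x<x+y _ 0<D
      ... | no i≢ | no j≢ = begin-strict
        u (suc n) i * x (suc n) j        ≈⟨ *-cong (u.kept n i≢) (x.kept n j≢) ⟩
        u n i * x n j                    <⟨ minors i j ⟩
        u n j * x n i + D                ≈⟨ +-congʳ (*-cong (u.kept n j≢) (x.kept n i≢)) ⟨
        u (suc n) j * x (suc n) i + D    ∎
      ... | yes ≡.refl | no j≢ = begin-strict
        u (suc n) i * x (suc n) j              ≈⟨ *-cong (u.moved n j≢) (x.kept n j≢) ⟩
        (u n j + u n h) * x n j                ≈⟨ distribʳ _ _ _ ⟩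
        u n j * x n j + u n h * x n j          <⟨ +-monoʳ-< _ (minors h j) ⟩
        u n j * x n j + (u n j * x n h + D)    ≈⟨ solve 4 (λ U X H D → U :* X :+ (U :* H :+ D) := U :* (X :+ H) :+ D) refl (u n j) (x n j) (x n h) D ⟩
        u n j * (x n j + x n h) + D            ≈⟨ +-congʳ (*-cong (u.kept n j≢) (x.moved n j≢)) ⟨
        u (suc n) j * x (suc n) i + D          ∎
        where h = third (w n) j
      ... | no i≢ | yes ≡.refl = begin-strict
        u (suc n) i * x (suc n) j              ≈⟨ *-cong (u.kept n i≢) (x.moved n i≢) ⟩
        u n i * (x n i + x n h)                ≈⟨ distribˡ _ _ _ ⟩
        u n i * x n i + u n i * x n h          <⟨ +-monoʳ-< _ (minors i h) ⟩
        u n i * x n i + (u n h * x n i + D)    ≈⟨ solve 4 (λ U X H D → U :* X :+ (H :* X :+ D) := (U :+ H) :* X :+ D) refl (u n i) (x n i) (u n h) D ⟩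
        (u n i + u n h) * x n i + D            ≈⟨ +-congʳ (*-cong (u.moved n i≢) (x.kept n i≢)) ⟨
        u (suc n) j * x (suc n) i + D          ∎
        where h = third (w n) i

      opaque
        minors-bounded : ∃[ D ] (0# < D × (∀ n → MinorsBelow D n))
        -- Bounding the row bounds makes `D` exceed all nine products at time 0.
        minors-bounded with upperBound (λ i → proj₁ (upperBound (λ j → u 0 i * x 0 j)))
        ... | D , 0<D , row<D = D , 0<D , below
          where
          below : ∀ n → MinorsBelow D n
          below (suc n) = minors-step 0<D (below n)
          below zero i j = begin-strict
            u 0 i * x 0 j        <⟨ proj₂ (proj₂ (upperBound (λ j → u 0 i * x 0 j))) j ⟩
            proj₁ (upperBound (λ j → u 0 i * x 0 j))
                                 <⟨ row<D i ⟩
            D                    <⟨ x<x+y D (*-pos (u.positive 0 j) (x.positive 0 i)) ⟩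
            D + u 0 j * x 0 i    ≈⟨ +-comm D _ ⟩
            u 0 j * x 0 i + D    ∎

      -- Closeness of the quotients to `q` with denominators cleared: being linear, it passes to
      -- sums of components.
      Proportional : ℝ → ℝ → ℕ → Set ℓ₃
      Proportional ε q n = ∀ j → Close (ε * x n j) (u n j) (q * x n j)

      proportional-step : ∀ {ε q} n → Proportional ε q n → Proportional ε q (suc n)
      proportional-step n close j with j ≟ w n
      ... | no  j≢     = Close-resp (*-congˡ (sym (x.kept n j≢))) (sym (u.kept n j≢))
                           (*-congˡ (sym (x.kept n j≢))) (close j)
      ... | yes ≡.refl = Close-resp (scaled-sum _) (sym (u.moved n i≢)) (scaled-sum _)
                           (Close-+ (close i) (close (third j i)))
        where
        -- Some letter other than `j`; either one would do.
        i = punchIn j 0F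
        i≢ = punchInᵢ≢i j 0F

        scaled-sum : ∀ a → a * x n i + a * x n (third j i) ≈ a * x (suc n) j
        scaled-sum a = trans (sym (distribˡ a _ _)) (*-congˡ (sym (x.moved n i≢)))

      proportional-persists : ∀ {ε q n n′} → n ℕ.≤′ n′ → Proportional ε q n → Proportional ε q n′
      proportional-persists (ℕ.≤′-reflexive ≡.refl) close = close
      proportional-persists (ℕ.≤′-step n≤n′)        close =
        proportional-step _ (proportional-persists n≤n′ close)

      opaque
        -- The centre is the quotient at the letter `l` moved last. The minor of `j` and `l` is less
        -- than `D` in absolute value, so after division by `x n l` it is below `ε * x n j` as soon
        -- as `D < ε * (x n j * x n l)`.
        eventually-proportional : Reduced w → ∀ ε → 0# < ε → ∃[ q ] ∃[ n ] Proportional ε q n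
        eventually-proportional reduced ε 0<ε with minors-bounded
        -- `M` is chosen from the lower bounds `m` for `x n j` and `ι M * m` for `x n l`.
        ... | D , 0<D , minors with archimedean-* D (*-pos 0<ε (*-pos 0<m 0<m))
          where open Growth reduced xOrbit
        ... | M , D<M = u n l * r , n , λ j →
          Close-resp (trans (solve 4 (λ ε X L r → ε :* (X :* L) :* r := ε :* X :* (L :* r)) refl ε (x n j) (x n l) r)
                            (*-*-recip _ 0<xₗ))
                     (trans (*-assoc (u n j) (x n l) r) (*-*-recip _ 0<xₗ))
                     (solve 3 (λ U X r → U :* X :* r := U :* r :* X) refl (u n l) (x n j) r)
                     (Close-* (0<recip 0<xₗ)
                       (within (<-trans (minors n j l) (+-monoʳ-< _ (large j)))
                               (<-trans (minors n l j) (+-monoʳ-< _ (large j)))))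
          where
          open Growth reduced xOrbit
          n : ℕ
          n = suc M

          l : Fin 3
          l = w M

          0<xₗ : 0# < x n l
          0<xₗ = x.positive n l

          r : ℝ
          r = recip 0<xₗ

          large : ∀ j → D < ε * (x n j * x n l)
          large j = begin-strict
            D                        <⟨ D<M ⟩
            ι M * (ε * (m * m))      ≈⟨ solve 3 (λ k ε m → k :* (ε :* (m :* m)) := ε :* (m :* (k :* m))) refl (ι M) ε m ⟩
            ε * (m * (ι M * m))      <⟨ *-monoʳ-< 0<ε (*-monoʳ-< 0<m (n*m<last M)) ⟩
            ε * (m * x n l)          <⟨ *-monoʳ-< 0<ε (*-monoˡ-< 0<xₗ (m<x M j)) ⟩
            ε * (x n j * x n l)      ∎

      quotient : Fin 3 → ℕ → ℝ
      quotient j n = u n j * recip (x.positive n j)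

      quotients-converge : Reduced w → ∃[ q ] (∀ j → quotient j ⟶ q)
      quotients-converge reduced = common-limit 0F quotient close
        where
        close : ∀ ε → 0# < ε → ∃[ q ] EventuallyClose quotient ε q
        close ε 0<ε with eventually-proportional reduced ε 0<ε
        ... | q , N , proportional = q , N , λ n N≤n j →
          let 0<x = x.positive n j
          in Close-resp (cancel ε 0<x) refl (cancel q 0<x)
               (Close-* (0<recip 0<x) (proportional-persists (ℕₚ.≤⇒≤′ N≤n) proportional j))
          where
          cancel : ∀ a {y} (0<y : 0# < y) → a * y * recip 0<y ≈ a
          cancel a 0<y = trans (*-assoc a _ _) (*-*-recip a 0<y)

  -- Application to the generalized Euclid tree.

  𝓜-kept : ∀ k i t {j} → j ≢ i → lookup (𝓜 k i t) j ≡ lookup t j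
  𝓜-kept k 0F (_ ∷ _ ∷ _ ∷ []) {0F} j≢i = contradiction ≡.refl j≢i
  𝓜-kept k 0F (_ ∷ _ ∷ _ ∷ []) {1F} j≢i = ≡.refl
  𝓜-kept k 0F (_ ∷ _ ∷ _ ∷ []) {2F} j≢i = ≡.refl
  𝓜-kept k 1F (_ ∷ _ ∷ _ ∷ []) {0F} j≢i = ≡.refl
  𝓜-kept k 1F (_ ∷ _ ∷ _ ∷ []) {1F} j≢i = contradiction ≡.refl j≢i
  𝓜-kept k 1F (_ ∷ _ ∷ _ ∷ []) {2F} j≢i = ≡.refl
  𝓜-kept k 2F (_ ∷ _ ∷ _ ∷ []) {0F} j≢i = ≡.refl
  𝓜-kept k 2F (_ ∷ _ ∷ _ ∷ []) {1F} j≢i = ≡.refl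
  𝓜-kept k 2F (_ ∷ _ ∷ _ ∷ []) {2F} j≢i = contradiction ≡.refl j≢i

  component : Vec ℝ₊ 3 → Fin 3 → ℝ
  component t j = ℝ₊.value (lookup t j)

  𝓜-moved : ∀ k i t {j} → j ≢ i →
    component (𝓜 k i t) i ≈ ℝ≥0.value k + (component t j + component t (third i j))
  𝓜-moved k 0F (_ ∷ _ ∷ _ ∷ []) {0F} j≢i = contradiction ≡.refl j≢i
  𝓜-moved k 0F (_ ∷ _ ∷ _ ∷ []) {1F} j≢i = +-assoc _ _ _
  𝓜-moved k 0F (_ ∷ _ ∷ _ ∷ []) {2F} j≢i = trans (+-assoc _ _ _) (+-congˡ (+-comm _ _))
  𝓜-moved k 1F (_ ∷ _ ∷ _ ∷ []) {0F} j≢i = +-assoc _ _ _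
  𝓜-moved k 1F (_ ∷ _ ∷ _ ∷ []) {1F} j≢i = contradiction ≡.refl j≢i
  𝓜-moved k 1F (_ ∷ _ ∷ _ ∷ []) {2F} j≢i = trans (+-assoc _ _ _) (+-congˡ (+-comm _ _))
  𝓜-moved k 2F (_ ∷ _ ∷ _ ∷ []) {0F} j≢i = +-assoc _ _ _
  𝓜-moved k 2F (_ ∷ _ ∷ _ ∷ []) {1F} j≢i = trans (+-assoc _ _ _) (+-congˡ (+-comm _ _))
  𝓜-moved k 2F (_ ∷ _ ∷ _ ∷ []) {2F} j≢i = contradiction ≡.refl j≢i

  module _ (k : ℝ≥0) (w : ℕ → Fin 3) (T t : Vec ℝ₊ 3) where
    open Orbits w
    private κ = ℝ≥0.value k

    U X x : ℕ → Fin 3 → ℝ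
    X n j = component (𝓜^ k w n T) j
    U n j = X n j + κ
    x n j = component (𝓜^ 0≥0 w n t) j

    x-orbit : IsOrbit x
    x-orbit = record
      { positive = λ n j → ℝ₊.0<value (lookup (𝓜^ 0≥0 w n t) j)
      ; moved    = λ n j≢ → trans (𝓜-moved 0≥0 (w n) (𝓜^ 0≥0 w n t) j≢) (+-identityˡ _)
      ; kept     = λ n j≢ → reflexive (≡.cong ℝ₊.value (𝓜-kept 0≥0 (w n) (𝓜^ 0≥0 w n t) j≢))
      }

    U-orbit : IsOrbit U
    U-orbit = record
      { positive = λ n j → <-respʳ (+-comm κ (X n j)) (nonNeg+pos (ℝ≥0.0≤value k) (ℝ₊.0<value (lookup (𝓜^ k w n T) j)))
      ; moved    = λ n {j} j≢ → trans (+-congʳ (𝓜-moved k (w n) (𝓜^ k w n T) j≢))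
          (solve 3 (λ κ a b → κ :+ (a :+ b) :+ κ := a :+ κ :+ (b :+ κ)) refl κ (X n j) (X n (third (w n) j)))
      ; kept     = λ n j≢ → +-congʳ (reflexive (≡.cong ℝ₊.value (𝓜-kept k (w n) (𝓜^ k w n T) j≢)))
      }

    open Comparison U-orbit x-orbit

    -- The ratio differs from `quotient j` by `κ` over `x n j`, which vanishes in the limit because
    -- `x n j` diverges. The threshold `κ * recip 0<δ` makes this difference less than `δ`.
    ratio-converges : Reduced w → ∀ {q j} → quotient j ⟶ q → InfinitelyOften w j → ratio k w T t j ⟶ q
    ratio-converges reduced {q} {j} U/x⟶q often ε 0<ε =
      let δ , 0<δ , 2δ≈ε = half 0<ε
          N , near = U/x⟶q δ 0<δ
          M , large = Growth.diverges reduced x-orbit often (κ * recip 0<δ)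
      in N ⊔ M , λ n N⊔M≤n → Close⇒∣-∣< (Close-resp-ε 2δ≈ε (Close-trans
        (X/x-near 0<δ n (large n (ℕₚ.≤-trans (ℕₚ.m≤n⊔m N M) N⊔M≤n)))
        (∣-∣<⇒Close (near n (ℕₚ.≤-trans (ℕₚ.m≤m⊔n N M) N⊔M≤n)))))
      where
      X/x-near : ∀ {δ} (0<δ : 0# < δ) n → κ * recip 0<δ < x n j →
        Close δ (ratio k w T t j n) (quotient j n)
      X/x-near {δ} 0<δ n κ/δ<x = Close-resp (trans (*-assoc δ _ _) (*-*-recip δ 0<x)) refl refl
        (Close-* (0<recip 0<x)
          (within
            -- `κ` may be 0, so strictness comes from the positive term `δ * x n j`.
            (<-respʳ (sym (+-assoc _ _ _)) (x<x+y _ (nonNeg+pos (ℝ≥0.0≤value k) (*-pos 0<δ 0<x))))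
            (+-monoʳ-< _ κ<δ*x)))
        where
        0<x : 0# < x n j
        0<x = ℝ₊.0<value (lookup (𝓜^ 0≥0 w n t) j)

        κ<δ*x : κ < δ * x n j
        κ<δ*x = begin-strict
          κ                      ≈⟨ *-*-recip κ 0<δ ⟨
          κ * (δ * recip 0<δ)    ≈⟨ solve 3 (λ κ δ r → κ :* (δ :* r) := δ :* (κ :* r)) refl κ δ _ ⟩
          δ * (κ * recip 0<δ)    <⟨ *-monoʳ-< 0<δ κ/δ<x ⟩
          δ * x n j              ∎

    -- A single `q`, the limit of the shifted quotients, serves every recurring letter; this covers
    -- both halves of the theorem.
    ratios-converge : Reduced w → ∃[ q ] (∀ j → InfinitelyOften w j → ratio k w T t j ⟶ q)
    ratios-converge reduced =
      let q , U/x⟶q = quotients-converge reduced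
      in q , λ j → ratio-converges reduced (U/x⟶q j)

theorem5p10 : {c ℓ₁ ℓ₂ ℓ₃ : Level} (R : Reals c ℓ₁ ℓ₂ ℓ₃) → let open EuclidTree R in
    (k : ℝ≥0) (T t : Vec ℝ₊ 3) → Initial k T → Initial 0≥0 t →
    (w : ℕ → Fin 3) → Reduced w →
    ((∀ i → InfinitelyOften w i) →
    ∃[ q ] (∀ j → ratio k w T t j ⟶ q))
    ×
    (∀ i → FinitelyOften w i →
    ∃[ q ] (∀ j → j ≢ i → ratio k w T t j ⟶ q))
theorem5p10 R k T t _ _ w reduced =
  let q , converges = ratios-converge R k w T t reduced
  in (λ often → q , λ j → converges j (often j)) ,
     (λ i finite → q , λ j j≢i → converges j (finitelyOften⇒infinitelyOften reduced finite j j≢i))
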